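{- Let $s,k\geq 2$ be integers with $s\geq 2k$, and let $c(k,s) = \frac{k!}{k^k (2s(1 + 2^{k}))^{2^k}}$. Let $\mathcal{F}$ be a $k$-graph on $[n]$. Then there exists a $k$-partite subgraph $\mathcal{F}'\subseteq \mathcal{F}$ with some $k$-partition $(X_1,\dots,X_k)$ such that: (1) $|\mathcal{F}'|\geq c(k,s)|\mathcal{F}|$; (2) for every $J\in \mathrm{MI}(\mathcal{F}')$ and every $F\in\mathcal{F}'$, the set $F_J$ is $s$-strong in $\mathcal{F}'$; (3) for every $F\in \mathcal{F}'$ and $J\in \mathrm{MI}(\mathcal{F}')$, $d_{\mathcal{F}'}(F_J)\geq \max\{s, \frac{1}{2k}\frac{|\mathcal{F}'|}{n^{|J|}}\}$.
   Context: A $k$-graph $\mathcal{F}$ is $k$-partite with $k$-partition $(X_1,\dots,X_k)$ (a partition of the vertex set) if every edge contains exactly one vertex of each $X_i$. For $J\subseteq[k]$ and an edge $F$, $F_J:=F\cap\bigcup_{i\in J}X_i$. For a set $D$ contained in an edge, its pattern is $\pi(D)=\{i\in[k]: D\cap X_i\neq\emptyset\}$. $\mathrm{MI}(\mathcal{F})=\{\pi(E\cap F): E,F\in\mathcal{F}, E\neq F\}$ (computed with respect to the partition). The link of $D$ in $\mathcal{F}$ is $\mathcal{L}_{\mathcal{F}}(D)=\{F\setminus D: F\in\mathcal{F}, D\subseteq F\}$ (the empty set may be a member), and $d_{\mathcal{F}}(D)=|\mathcal{L}_{\mathcal{F}}(D)|$. A nonempty hypergraph $\mathcal{L}$ is $s$-diverse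 if every vertex $v$ satisfies $d_{\mathcal{L}}(v)<|\mathcal{L}|/s$. A set $D$ is $s$-strong in $\mathcal{F}$ if $\mathcal{L}_{\mathcal{F}}(D)$ is $s$-diverse. -}

module Defs where

open import Data.Nat using (ℕ; zero; suc; _*_; _<_; _≤_; _^_)
open import Data.Bool using (Bool; true; false; _∧_)
open import Data.Fin using (Fin)
open import Data.Fin.Subset using (Subset; _∈_; _⊆_; _─_; _∩_; ∣_∣; ⁅_⁆)
open import Data.Fin.Subset.Properties using (_∈?_; _⊆?_)
open import Data.Vec using (tabulate; lookup)
open import Data.List using (List; length; filter; map)
open import Data.List.Membership.Propositional using () renaming (_∈_ to _∈ₗ_)
open import Data.List.Relation.Unary.All using (All)
open import Data.List.Relation.Unary.Unique.Propositional using (Unique)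
open import Data.Product using (Σ; _×_; ∃)
open import Relation.Binary.PropositionalEquality using (_≡_; _≢_)

-- A hypergraph on vertex set Fin n: a duplicate-free list of edges (subsets of Fin n).
Hypergraph : ℕ → Set
Hypergraph n = List (Subset n)

IsKGraph : (k n : ℕ) → Hypergraph n → Set
IsKGraph k n F = Unique F × All (λ E → ∣ E ∣ ≡ k) F

IsSubgraph : {n : ℕ} → Hypergraph n → Hypergraph n → Set
IsSubgraph F' F = Unique F' × All (λ E → E ∈ₗ F) F'

-- A k-partition (X_1,…,X_k) of Fin n, encoded by the part-index map col (X_i = col⁻¹(i)).
Partition : (k n : ℕ) → Set
Partition k n = Fin n → Fin k

part : {k n : ℕ} → Partition k n → Fin k → Subset n
part col i = tabulate (λ v → lookup ⁅ i ⁆ (col v))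

IsKPartite : {k n : ℕ} → Partition k n → Hypergraph n → Set
IsKPartite {k} col F = All (λ E → (i : Fin k) → ∣ E ∩ part col i ∣ ≡ 1) F

nonzero : ℕ → Bool
nonzero zero = false
nonzero (suc _) = true

patternOf : {k n : ℕ} → Partition k n → Subset n → Subset k
patternOf col D = tabulate (λ i → nonzero ∣ D ∩ part col i ∣)

InMI : {k n : ℕ} → Partition k n → Hypergraph n → Subset k → Set
InMI col F J = Σ _ λ E → Σ _ λ G → (E ∈ₗ F) × (G ∈ₗ F) × (E ≢ G) × (patternOf col (E ∩ G) ≡ J)

restrict : {k n : ℕ} → Partition k n → Subset n → Subset k → Subset n
restrict col F J = tabulate (λ v → lookup F v ∧ lookup J (col v))

-- link L_F(D) = { F ∖ D : F ∈ F, D ⊆ F }  (as a list; distinct since F is duplicate-free)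
link : {n : ℕ} → Hypergraph n → Subset n → Hypergraph n
link F D = map (λ E → E ─ D) (filter (λ E → D ⊆? E) F)

deg : {n : ℕ} → Hypergraph n → Subset n → ℕ
deg F D = length (link F D)

vdeg : {n : ℕ} → Hypergraph n → Fin n → ℕ
vdeg L v = length (filter (λ E → v ∈? E) L)

-- L is s-diverse: nonempty and every vertex v has d_L(v) < |L| / s, i.e. s·d_L(v) < |L|
Diverse : {n : ℕ} → ℕ → Hypergraph n → Set
Diverse {n} s L = (0 < length L) × ((v : Fin n) → s * vdeg L v < length L)

Strong : {n : ℕ} → ℕ → Hypergraph n → Subset n → Set
Strong s F D = Diverse s (link F D)

{-# OPTIONS --safe #-}

-- A uniformly random k-colouring makes each edge rainbow with probability k!/k^k, which yields the
-- k-partite start. Let R be a set of patterns containing MI(F), and N = |F|. Repeatedly delete all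
-- edges through a set D that is either light, |D| < k and d(D) < N/(2k n^|D|), or of the form E_J
-- with J ∈ R and not s-strong. There are at most n^j sets of each size j < k, so light deletions
-- remove at most N/2 edges. Hence the surviving core or the edges deleted on account of one J ∈ R
-- number at least N/(2(1+2^k)). The core is as required. In the other case, each deleted star of
-- D = E_J has a vertex v in at least 1/s of its edges; keeping only those edges gives a subgraph
-- of size at least N/(2s(1+2^k)) whose MI misses J, and one repeats with R ∖ {J}.
module Submission where

open import Defs
open import Data.Bool using (Bool; true; false; _∧_; T; T?; if_then_else_)
open import Data.Bool.Properties using () renaming (_≟_ to _≟ᵇ_)
open import Data.Fin using (Fin; zero; suc)
import Data.Fin.Properties as Fin
open import Data.Fin.Subset using (Subset; ∣_∣; ⁅_⁆; _∩_; _─_; _-_; _⊆_; _∈_; _∉_; ⊤; Nonempty; outside)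
open import Data.Fin.Subset.Properties
open import Data.List using (List; []; _∷_; _++_; length; filter; map; tabulate; allFin; cartesianProductWith)
open import Data.List.Membership.Propositional using (find; lose) renaming (_∈_ to _∈ₗ_)
open import Data.List.Membership.Propositional.Properties using (∈-filter⁻; ∈-filter⁺; ∈-++⁻; ∈-map⁺; ∈-map⁻; ∈-++⁺ˡ; ∈-++⁺ʳ)
open import Data.List.Properties using (map-++; map-∘; map-tabulate; length-tabulate; length-map; length-filter; filter-notAll; filter-some; length-++)
open import Data.List.Relation.Unary.All as All using (All; []; _∷_)
import Data.List.Relation.Unary.All.Properties as All
open import Data.List.Relation.Unary.AllPairs using ([])
open import Data.List.Relation.Unary.Any as Any using (Any; any?; here; there)
open import Data.List.Relation.Unary.Unique.Propositional using (Unique)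
import Data.List.Relation.Unary.Unique.Propositional.Properties as Unique
open import Data.Maybe using (Maybe; just; nothing; maybe)
open import Data.Nat using (ℕ; zero; suc; _+_; _*_; _∸_; _≤_; _<_; _^_; _!; _<?_; _≤?_; NonZero; >-nonZero; z≤n; s≤s; z<s)
open import Data.Nat.Induction using (Acc; acc; <-wellFounded)
open import Data.Nat.ListAction using (sum)
open import Data.Nat.ListAction.Properties using (sum-++)
open import Data.Nat.Properties hiding (_≟_; _<?_; _≤?_)
open import Data.Nat.Solver using (module +-*-Solver)
open import Data.Product using (Σ; _×_; _,_; proj₁; proj₂; ∃)
open import Data.Sum using (_⊎_; inj₁; inj₂)
open import Data.Vec using (Vec; []; _∷_; lookup; _[_]≔_; here; there)
open import Data.Vec.Properties using (lookup∘update; lookup∘update′; lookup∘tabulate; lookup⇒[]=; []=⇒lookup; lookup-replicate; ≡-dec)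
open import Function using (_∘_; id)
open import Relation.Binary.PropositionalEquality using (_≡_; _≢_; refl; sym; trans; cong; cong₂; subst; module ≡-Reasoning)
open import Relation.Nullary using (¬_; Dec; yes; no; does; contradiction; ¬?; _×-dec_)
open import Relation.Unary using (Decidable)
open +-*-Solver using (solve; _:+_; _:*_; _:=_; con)

private variable
  A B C : Set
  k n : ℕ

-- Finite sums over lists.

∑ : (A → ℕ) → List A → ℕ
∑ f xs = sum (map f xs)

∑-mono : {f g : A → ℕ} (xs : List A) → (∀ {x} → x ∈ₗ xs → f x ≤ g x) → ∑ f xs ≤ ∑ g xs
∑-mono []       h = z≤n
∑-mono (x ∷ xs) h = +-mono-≤ (h (here refl)) (∑-mono xs (h ∘ there))

∑-cong : {f g : A → ℕ} (xs : List A) → (∀ {x} → x ∈ₗ xs → f x ≡ g x) → ∑ f xs ≡ ∑ g xs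
∑-cong []       h = refl
∑-cong (x ∷ xs) h = cong₂ _+_ (h (here refl)) (∑-cong xs (h ∘ there))

∑-const : (c : ℕ) (xs : List A) → ∑ (λ _ → c) xs ≡ length xs * c
∑-const c []       = refl
∑-const c (x ∷ xs) = cong (c +_) (∑-const c xs)

∑-++ : (f : A → ℕ) (xs ys : List A) → ∑ f (xs ++ ys) ≡ ∑ f xs + ∑ f ys
∑-++ f xs ys = trans (cong sum (map-++ f xs ys)) (sum-++ (map f xs) (map f ys))

∑-*ʳ : (f : A → ℕ) (c : ℕ) (xs : List A) → ∑ f xs * c ≡ ∑ (λ x → f x * c) xs
∑-*ʳ f c []       = refl
∑-*ʳ f c (x ∷ xs) = trans (*-distribʳ-+ c (f x) (∑ f xs)) (cong (f x * c +_) (∑-*ʳ f c xs))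

∑-+ : (f g : A → ℕ) (xs : List A) → ∑ (λ x → f x + g x) xs ≡ ∑ f xs + ∑ g xs
∑-+ f g []       = refl
∑-+ f g (x ∷ xs) = trans (cong (f x + g x +_) (∑-+ f g xs))
  (solve 4 (λ a b c d → a :+ b :+ (c :+ d) := a :+ c :+ (b :+ d)) refl (f x) (g x) (∑ f xs) (∑ g xs))

∑-swap : (f : A → B → ℕ) (xs : List A) (ys : List B) →
  ∑ (λ x → ∑ (f x) ys) xs ≡ ∑ (λ y → ∑ (λ x → f x y) xs) ys
∑-swap f []       ys = sym (trans (∑-const 0 ys) (*-zeroʳ (length ys)))
∑-swap f (x ∷ xs) ys = trans (cong (∑ (f x) ys +_) (∑-swap f xs ys)) (sym (∑-+ (f x) _ ys))

∑-cartesianProductWith : (f : C → ℕ) (g : A → B → C) (xs : List A) (ys : List B) →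
  ∑ f (cartesianProductWith g xs ys) ≡ ∑ (λ x → ∑ (λ y → f (g x y)) ys) xs
∑-cartesianProductWith f g []       ys = refl
∑-cartesianProductWith f g (x ∷ xs) ys = trans (∑-++ f (map (g x) ys) _)
  (cong₂ _+_ (cong sum (sym (map-∘ ys))) (∑-cartesianProductWith f g xs ys))

-- Averaging, with a maximal entry as the witness. It picks a good colouring, and later the largest
-- of the classes into which the edges are split.
∑≤length*max : (f : A → ℕ) (xs : List A) → 0 < length xs → ∃ λ y → y ∈ₗ xs × ∑ f xs ≤ length xs * f y
∑≤length*max f (x ∷ [])     _ = x , here refl , ≤-refl
∑≤length*max f (x ∷ z ∷ xs) _ with ∑≤length*max f (z ∷ xs) z<s
... | y , y∈ , le with ≤-total (f x) (f y)
... | inj₁ fx≤fy = y , there y∈ , +-mono-≤ fx≤fy le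
... | inj₂ fy≤fx = x , here refl , +-monoʳ-≤ (f x) (≤-trans le (*-monoʳ-≤ (length (z ∷ xs)) fy≤fx))

-- Counting rainbow colourings.

bit : Bool → ℕ
bit false = 0
bit true  = 1

length-filter-T : (p : A → Bool) (xs : List A) → length (filter (T? ∘ p) xs) ≡ ∑ (bit ∘ p) xs
length-filter-T p []       = refl
length-filter-T p (x ∷ xs) with p x
... | false = length-filter-T p xs
... | true  = cong suc (length-filter-T p xs)

∑-lookup : (S : Subset k) → ∑ (bit ∘ lookup S) (allFin k) ≡ ∣ S ∣
∑-lookup S = trans (cong sum (map-tabulate id (bit ∘ lookup S))) (go S)
  where
  go : ∀ {k} (S : Subset k) → sum (tabulate (bit ∘ lookup S)) ≡ ∣ S ∣
  go []          = refl
  go (false ∷ S) = go S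
  go (true ∷ S)  = cong suc (go S)

∣-∣-remove : (S : Subset k) (c : Fin k) → lookup S c ≡ true → suc ∣ S [ c ]≔ outside ∣ ≡ ∣ S ∣
∣-∣-remove (true ∷ S)  zero    refl = refl
∣-∣-remove (false ∷ S) (suc c) c∈S  = ∣-∣-remove S c c∈S
∣-∣-remove (true ∷ S)  (suc c) c∈S  = cong suc (∣-∣-remove S c c∈S)

∣S∣≡0⇒lookup≡false : (S : Subset k) (i : Fin k) → ∣ S ∣ ≡ 0 → lookup S i ≡ false
∣S∣≡0⇒lookup≡false (false ∷ S) zero    _ = refl
∣S∣≡0⇒lookup≡false (false ∷ S) (suc i) e = ∣S∣≡0⇒lookup≡false S i e

-- The colours of E are distinct and lie in S; coverage of S is not tested, it follows when ∣ E ∣ ≡ ∣ S ∣.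
rainbow : Vec (Fin k) n → Subset n → Subset k → Bool
rainbow []       []          S = true
rainbow (c ∷ cs) (false ∷ E) S = rainbow cs E S
rainbow (c ∷ cs) (true ∷ E)  S = lookup S c ∧ rainbow cs E (S [ c ]≔ outside)

colourings : (k n : ℕ) → List (Vec (Fin k) n)
colourings k zero    = [] ∷ []
colourings k (suc n) = cartesianProductWith _∷_ (allFin k) (colourings k n)

length-allFin : (k : ℕ) → length (allFin k) ≡ k
length-allFin k = length-tabulate {n = k} id

length-colourings : (k n : ℕ) → length (colourings k n) ≡ k ^ n
length-colourings k zero    = refl
length-colourings k (suc n) = begin
  length (colourings k (suc n))                   ≡⟨ *-identityʳ _ ⟨
  length (colourings k (suc n)) * 1               ≡⟨ ∑-const 1 (colourings k (suc n)) ⟨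
  ∑ (λ _ → 1) (colourings k (suc n))              ≡⟨ ∑-cartesianProductWith _ _∷_ (allFin k) (colourings k n) ⟩
  ∑ (λ _ → ∑ (λ _ → 1) (colourings k n)) (allFin k) ≡⟨ ∑-const _ (allFin k) ⟩
  length (allFin k) * ∑ (λ _ → 1) (colourings k n) ≡⟨ cong₂ _*_ (length-allFin k) (trans (∑-const 1 (colourings k n)) (*-identityʳ (length (colourings k n)))) ⟩
  k * length (colourings k n)                     ≡⟨ cong (k *_) (length-colourings k n) ⟩
  k * k ^ n ∎
  where open ≡-Reasoning

-- Induction over the vertices: one outside `E` has `k` free colours, one in `E` takes any of the
-- `∣ S ∣` colours left and strikes it from `S`. The factor `k ^ ∣ E ∣` replaces a division, so this
-- is the probability `∣ E ∣ ! / k ^ ∣ E ∣`.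
count-rainbow : (E : Subset n) (S : Subset k) → ∣ E ∣ ≡ ∣ S ∣ →
  ∑ (λ cs → bit (rainbow cs E S)) (colourings k n) * k ^ ∣ E ∣ ≡ ∣ E ∣ ! * k ^ n
count-rainbow [] S _ = refl
count-rainbow {n = suc n} {k = k} (false ∷ E) S eq = begin
  ∑ (λ cs → bit (rainbow cs (false ∷ E) S)) (colourings k (suc n)) * k ^ ∣ E ∣
    ≡⟨ cong (_* k ^ ∣ E ∣) (∑-cartesianProductWith _ _∷_ (allFin k) (colourings k n)) ⟩
  ∑ (λ _ → N) (allFin k) * k ^ ∣ E ∣
    ≡⟨ cong (_* k ^ ∣ E ∣) (trans (∑-const N (allFin k)) (cong (_* N) (length-allFin k))) ⟩
  k * N * k ^ ∣ E ∣
    ≡⟨ *-assoc k N _ ⟩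
  k * (N * k ^ ∣ E ∣)
    ≡⟨ cong (k *_) (count-rainbow E S eq) ⟩
  k * (∣ E ∣ ! * k ^ n)
    ≡⟨ solve 3 (λ a b c → a :* (b :* c) := b :* (a :* c)) refl k (∣ E ∣ !) (k ^ n) ⟩
  ∣ E ∣ ! * (k * k ^ n) ∎
  where
  open ≡-Reasoning
  N = ∑ (λ cs → bit (rainbow cs E S)) (colourings k n)
count-rainbow {n = suc n} {k = k} (true ∷ E) S eq = begin
  ∑ (λ cs → bit (rainbow cs (true ∷ E) S)) (colourings k (suc n)) * k ^ suc ∣ E ∣
    ≡⟨ cong (_* k ^ suc ∣ E ∣) (∑-cartesianProductWith _ _∷_ (allFin k) (colourings k n)) ⟩
  ∑ N (allFin k) * k ^ suc ∣ E ∣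
    ≡⟨ ∑-*ʳ N (k ^ suc ∣ E ∣) (allFin k) ⟩
  ∑ (λ c → N c * k ^ suc ∣ E ∣) (allFin k)
    ≡⟨ ∑-cong (allFin k) (λ {c} _ → step c) ⟩
  ∑ (λ c → bit (lookup S c) * (k * (∣ E ∣ ! * k ^ n))) (allFin k)
    ≡⟨ ∑-*ʳ (bit ∘ lookup S) _ (allFin k) ⟨
  ∑ (bit ∘ lookup S) (allFin k) * (k * (∣ E ∣ ! * k ^ n))
    ≡⟨ cong (_* (k * (∣ E ∣ ! * k ^ n))) (trans (∑-lookup S) (sym eq)) ⟩
  suc ∣ E ∣ * (k * (∣ E ∣ ! * k ^ n))
    ≡⟨ solve 4 (λ a b c d → a :* (b :* (c :* d)) := (a :* c) :* (b :* d)) refl (suc ∣ E ∣) k (∣ E ∣ !) (k ^ n) ⟩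
  suc ∣ E ∣ ! * (k * k ^ n) ∎
  where
  open ≡-Reasoning
  N : Fin k → ℕ
  N c = ∑ (λ cs → bit (rainbow (c ∷ cs) (true ∷ E) S)) (colourings k n)
  step : ∀ c → N c * k ^ suc ∣ E ∣ ≡ bit (lookup S c) * (k * (∣ E ∣ ! * k ^ n))
  step c with lookup S c in c∈S
  ... | false = cong (_* k ^ suc ∣ E ∣) (trans (∑-const 0 (colourings k n)) (*-zeroʳ (length (colourings k n))))
  ... | true  = begin
    N′ * (k * k ^ ∣ E ∣)
      ≡⟨ solve 3 (λ a b c → a :* (b :* c) := b :* (a :* c)) refl N′ k (k ^ ∣ E ∣) ⟩
    k * (N′ * k ^ ∣ E ∣)
      ≡⟨ cong (k *_) (count-rainbow E S′ (suc-injective (trans eq (sym (∣-∣-remove S c c∈S))))) ⟩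
    k * (∣ E ∣ ! * k ^ n)
      ≡⟨ *-identityˡ _ ⟨
    1 * (k * (∣ E ∣ ! * k ^ n)) ∎
    where
    S′ = S [ c ]≔ outside
    N′ = ∑ (λ cs → bit (rainbow cs E S′)) (colourings k n)

-- Every vertex of `E` strikes its colour from `S` and the two sizes stay equal, so `S` is exhausted
-- at the end and each of its colours was used exactly once.
rainbow⇒∣E∩part∣ : (cs : Vec (Fin k) n) (E : Subset n) (S : Subset k) → ∣ E ∣ ≡ ∣ S ∣ → T (rainbow cs E S) →
  (i : Fin k) → ∣ E ∩ part (lookup cs) i ∣ ≡ bit (lookup S i)
rainbow⇒∣E∩part∣ []       []          S eq _ i = cong bit (sym (∣S∣≡0⇒lookup≡false S i (sym eq)))
rainbow⇒∣E∩part∣ (c ∷ cs) (false ∷ E) S eq r i = rainbow⇒∣E∩part∣ cs E S eq r i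
rainbow⇒∣E∩part∣ (c ∷ cs) (true ∷ E)  S eq r i with lookup S c in c∈S
... | true with rainbow⇒∣E∩part∣ cs E (S [ c ]≔ outside) (suc-injective (trans eq (sym (∣-∣-remove S c c∈S)))) r i | i Fin.≟ c
...   | rec | yes refl rewrite []=⇒lookup (x∈⁅x⁆ i) | c∈S = cong suc (trans rec (cong bit (lookup∘update i S outside)))
...   | rec | no i≢c with lookup ⁅ i ⁆ c in c∈i
...     | true  = contradiction (lookup⇒[]= c ⁅ i ⁆ c∈i) (x≢y⇒x∉⁅y⁆ (i≢c ∘ sym))
...     | false = trans rec (cong bit (lookup∘update′ i≢c S outside))


rainbowPart : Hypergraph n → Vec (Fin k) n → Hypergraph n
rainbowPart F cs = filter (λ E → T? (rainbow cs E ⊤)) F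

rainbowPart-partite : (F : Hypergraph n) (cs : Vec (Fin k) n) → All (λ E → ∣ E ∣ ≡ k) F →
  IsKPartite (lookup cs) (rainbowPart F cs)
rainbowPart-partite {k = k} F cs uni = All.tabulate λ {E} E∈ i → let E∈F , r = ∈-filter⁻ _ {xs = F} E∈ in
  trans (rainbow⇒∣E∩part∣ cs E ⊤ (trans (All.lookup uni E∈F) (sym (∣⊤∣≡n k))) r i) (cong bit (lookup-replicate i true))

-- Double counting of pairs of an edge and a colouring making it rainbow: summed by edges the count
-- is exact, summed by colourings it is at most `k ^ n` times the best one.
∃-large-rainbowPart : (k n : ℕ) .{{_ : NonZero k}} (F : Hypergraph n) → All (λ E → ∣ E ∣ ≡ k) F →
  ∃ λ (cs : Vec (Fin k) n) → k ! * length F ≤ k ^ k * length (rainbowPart F cs)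
∃-large-rainbowPart k n F uni = cs , *-cancelˡ-≤ (k ^ n) {{m^n≢0 k n}} (begin
  k ^ n * (k ! * length F)
    ≡⟨ solve 3 (λ a b c → a :* (b :* c) := c :* (b :* a)) refl (k ^ n) (k !) (length F) ⟩
  length F * (k ! * k ^ n)
    ≡⟨ ∑-const _ F ⟨
  ∑ (λ _ → k ! * k ^ n) F
    ≡⟨ ∑-cong F (λ {E} E∈F → count E (All.lookup uni E∈F)) ⟨
  ∑ (λ E → ∑ (λ cs → bit (rainbow cs E ⊤)) cols * k ^ k) F
    ≡⟨ ∑-*ʳ _ (k ^ k) F ⟨
  ∑ (λ E → ∑ (λ cs → bit (rainbow cs E ⊤)) cols) F * k ^ k
    ≡⟨ cong (_* k ^ k) (∑-swap (λ E cs → bit (rainbow cs E ⊤)) F cols) ⟩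
  ∑ size cols * k ^ k
    ≤⟨ *-monoˡ-≤ (k ^ k) avg ⟩
  k ^ n * size cs * k ^ k
    ≡⟨ cong (λ z → k ^ n * z * k ^ k) (length-filter-T (λ E → rainbow cs E ⊤) F) ⟨
  k ^ n * length (rainbowPart F cs) * k ^ k
    ≡⟨ solve 3 (λ a b c → a :* b :* c := a :* (c :* b)) refl (k ^ n) (length (rainbowPart F cs)) (k ^ k) ⟩
  k ^ n * (k ^ k * length (rainbowPart F cs)) ∎)
  where
  open ≤-Reasoning
  cols = colourings k n
  size : Vec (Fin k) n → ℕ
  size cs = ∑ (λ E → bit (rainbow cs E ⊤)) F
  count : ∀ E → ∣ E ∣ ≡ k → ∑ (λ cs → bit (rainbow cs E ⊤)) cols * k ^ k ≡ k ! * k ^ n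
  count E eq = subst (λ a → ∑ (λ cs → bit (rainbow cs E ⊤)) cols * k ^ a ≡ a ! * k ^ n) eq
    (count-rainbow E ⊤ (trans eq (sym (∣⊤∣≡n k))))
  best : ∃ λ cs → ∑ size cols ≤ k ^ n * size cs
  best with ∑≤length*max size cols (subst (0 <_) (sym (length-colourings k n)) (m^n>0 k n))
  ... | cs , _ , le = cs , subst (λ z → ∑ size cols ≤ z * size cs) (length-colourings k n) le
  cs = proj₁ best
  avg = proj₂ best

-- Auxiliary counts: sums with slack, filters, sizes of subsets.

-- A gain of `c` at one index survives in the sum. This serves both the drop of the light potential
-- and the growth of a single `S J`.
∑-mono-+ : {f g : A → ℕ} {c : ℕ} {y : A} {xs : List A} → (∀ x → f x ≤ g x) → y ∈ₗ xs → f y + c ≤ g y →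
  ∑ f xs + c ≤ ∑ g xs
∑-mono-+ {f = f} {g} {c} {xs = x ∷ xs} f≤g (here refl) le = begin
  f x + ∑ f xs + c   ≡⟨ solve 3 (λ a b c → a :+ b :+ c := a :+ c :+ b) refl (f x) (∑ f xs) c ⟩
  f x + c + ∑ f xs   ≤⟨ +-mono-≤ le (∑-mono xs (λ {z} _ → f≤g z)) ⟩
  g x + ∑ g xs       ∎
  where open ≤-Reasoning
∑-mono-+ {f = f} {g} {c} {xs = x ∷ xs} f≤g (there y∈) le = begin
  f x + ∑ f xs + c     ≡⟨ +-assoc (f x) (∑ f xs) c ⟩
  f x + (∑ f xs + c)   ≤⟨ +-mono-≤ (f≤g x) (∑-mono-+ f≤g y∈ le) ⟩
  g x + ∑ g xs         ∎
  where open ≤-Reasoning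

module _ {P : A → Set} (P? : Decidable P) where

  length-filter-+-¬ : (xs : List A) → length xs ≡ length (filter P? xs) + length (filter (¬? ∘ P?) xs)
  length-filter-+-¬ []       = refl
  length-filter-+-¬ (x ∷ xs) with does (P? x)
  ... | true  = cong suc (length-filter-+-¬ xs)
  ... | false = trans (cong suc (length-filter-+-¬ xs)) (sym (+-suc _ _))

  length-filter-map : (f : B → A) (xs : List B) → length (filter P? (map f xs)) ≡ length (filter (P? ∘ f) xs)
  length-filter-map f []       = refl
  length-filter-map f (x ∷ xs) with does (P? (f x))
  ... | true  = cong suc (length-filter-map f xs)
  ... | false = length-filter-map f xs

x∈p─q⇒x∉q : {x : Fin n} (p q : Subset n) → x ∈ p ─ q → x ∉ q
x∈p─q⇒x∉q (_ ∷ p) (_ ∷ q) (there x∈) (there x∈q) = x∈p─q⇒x∉q p q x∈ x∈q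

∣S∣≡1⇒unique : {S : Subset n} {x y : Fin n} → ∣ S ∣ ≡ 1 → x ∈ S → y ∈ S → x ≡ y
∣S∣≡1⇒unique {S = S} {x} {y} eq x∈S y∈S with x Fin.≟ y
... | yes x≡y = x≡y
... | no x≢y  = contradiction
  (≤-trans (s≤s (≤-trans (s≤s z≤n) (x∈p⇒∣p-x∣<∣p∣ {x = y} (x∈p∧x≢y⇒x∈p-y y∈S (x≢y ∘ sym))))) (x∈p⇒∣p-x∣<∣p∣ x∈S))
  (<-irrefl (sym eq))

nonzero-∣∣⁺ : {S : Subset n} {x : Fin n} → x ∈ S → nonzero ∣ S ∣ ≡ true
nonzero-∣∣⁺ {S = true ∷ S}  _          = refl
nonzero-∣∣⁺ {S = false ∷ S} (there x∈) = nonzero-∣∣⁺ x∈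

nonzero-∣∣⁻ : (S : Subset n) → nonzero ∣ S ∣ ≡ true → Nonempty S
nonzero-∣∣⁻ (true ∷ S)  _  = zero , here
nonzero-∣∣⁻ (false ∷ S) eq with nonzero-∣∣⁻ S eq
... | x , x∈S = suc x , there x∈S

-- The first vertex of `S` claims its image; injectivity keeps the other images off it, so `J` may
-- lose that point in the induction.
∣∣-injection : (f : Fin n → Fin k) (S : Subset n) (J : Subset k) → (∀ {v} → v ∈ S → f v ∈ J) →
  (∀ {v w} → v ∈ S → w ∈ S → f v ≡ f w → v ≡ w) → ∣ S ∣ ≤ ∣ J ∣
∣∣-injection f []          J _  _   = z≤n
∣∣-injection f (false ∷ S) J to inj = ∣∣-injection (f ∘ suc) S J (to ∘ there)
  (λ v∈ w∈ eq → Fin.suc-injective (inj (there v∈) (there w∈) eq))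
∣∣-injection f (true ∷ S)  J to inj = ≤-trans (s≤s (∣∣-injection (f ∘ suc) S (J - f zero)
    (λ v∈ → x∈p∧x≢y⇒x∈p-y (to (there v∈)) (λ eq → Fin.0≢1+n (sym (inj (there v∈) here eq))))
    (λ v∈ w∈ eq → Fin.suc-injective (inj (there v∈) (there w∈) eq))))
  (x∈p⇒∣p-x∣<∣p∣ (to here))

-- Transversals, restrictions and patterns.

module _ (col : Partition k n) where

  ∈-part⁺ : ∀ {v i} → col v ≡ i → v ∈ part col i
  ∈-part⁺ {v} refl = lookup⇒[]= v _ (trans (lookup∘tabulate _ v) ([]=⇒lookup (x∈⁅x⁆ (col v))))

  ∈-part⁻ : ∀ {v i} → v ∈ part col i → col v ≡ i
  ∈-part⁻ {v} {i} v∈ = x∈⁅y⁆⇒x≡y i (lookup⇒[]= (col v) ⁅ i ⁆ (trans (sym (lookup∘tabulate _ v)) ([]=⇒lookup v∈)))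

  ∈-restrict⁺ : ∀ {E J v} → v ∈ E → col v ∈ J → v ∈ restrict col E J
  ∈-restrict⁺ {v = v} v∈E c∈J =
    lookup⇒[]= v _ (trans (lookup∘tabulate _ v) (cong₂ _∧_ ([]=⇒lookup v∈E) ([]=⇒lookup c∈J)))

  ∈-restrict⁻ : ∀ E J {v} → v ∈ restrict col E J → v ∈ E × col v ∈ J
  ∈-restrict⁻ E J {v} v∈ with lookup E v in e₁ | lookup J (col v) in e₂ | trans (sym (lookup∘tabulate _ v)) ([]=⇒lookup v∈)
  ... | true | true | _ = lookup⇒[]= v E e₁ , lookup⇒[]= (col v) J e₂

  restrict-⊆ : ∀ E J → restrict col E J ⊆ E
  restrict-⊆ E J = proj₁ ∘ ∈-restrict⁻ E J

  ∈-patternOf⁺ : ∀ {D v} → v ∈ D → col v ∈ patternOf col D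
  ∈-patternOf⁺ {v = v} v∈D = lookup⇒[]= (col v) _
    (trans (lookup∘tabulate _ (col v)) (nonzero-∣∣⁺ (x∈p∩q⁺ (v∈D , ∈-part⁺ refl))))

  ∈-patternOf⁻ : ∀ D {i} → i ∈ patternOf col D → ∃ λ v → v ∈ D × col v ≡ i
  ∈-patternOf⁻ D {i} i∈ with nonzero-∣∣⁻ (D ∩ part col i) (trans (sym (lookup∘tabulate _ i)) ([]=⇒lookup i∈))
  ... | v , v∈ with x∈p∩q⁻ D (part col i) v∈
  ... | v∈D , v∈i = v , v∈D , ∈-part⁻ v∈i

  -- Meeting every part exactly once, stated through representatives: the arguments on patterns
  -- compare vertices of equal colour rather than cardinalities.
  record IsTransversal (E : Subset n) : Set where
    field
      hits   : ∀ i → ∃ λ v → v ∈ E × col v ≡ i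
      unique : ∀ {v w} → v ∈ E → w ∈ E → col v ≡ col w → v ≡ w

  open IsTransversal

  ∣E∩part∣≡1⇒transversal : ∀ {E} → (∀ i → ∣ E ∩ part col i ∣ ≡ 1) → IsTransversal E
  ∣E∩part∣≡1⇒transversal {E} one .hits i with nonzero-∣∣⁻ (E ∩ part col i) (cong nonzero (one i))
  ... | v , v∈ with x∈p∩q⁻ E (part col i) v∈
  ... | v∈E , v∈i = v , v∈E , ∈-part⁻ v∈i
  ∣E∩part∣≡1⇒transversal one .unique {v} {w} v∈E w∈E eq =
    ∣S∣≡1⇒unique (one (col w)) (x∈p∩q⁺ (v∈E , ∈-part⁺ eq)) (x∈p∩q⁺ (w∈E , ∈-part⁺ refl))

  ∣restrict∣≤∣J∣ : ∀ {E} J → IsTransversal E → ∣ restrict col E J ∣ ≤ ∣ J ∣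
  ∣restrict∣≤∣J∣ {E} J t = ∣∣-injection col (restrict col E J) J (proj₂ ∘ ∈-restrict⁻ E J)
    (λ v∈ w∈ → unique t (restrict-⊆ E J v∈) (restrict-⊆ E J w∈))

  pattern-full⇒⊆ : ∀ {X Y} → IsTransversal X → (∀ i → i ∈ patternOf col (X ∩ Y)) → X ⊆ Y
  pattern-full⇒⊆ {X} {Y} t full {v} v∈X with ∈-patternOf⁻ (X ∩ Y) (full (col v))
  ... | w , w∈ , eq with x∈p∩q⁻ X Y w∈
  ... | w∈X , w∈Y = subst (_∈ Y) (unique t w∈X v∈X eq) w∈Y

  -- A vertex of `D` has its colour in `J`, so `X ∩ Y` has a vertex of that colour; `X` has only
  -- one, hence the two coincide.
  ⊆-of-pattern : ∀ {D X Y J} → IsTransversal X → (∀ {v} → v ∈ D → col v ∈ J) → D ⊆ X →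
    patternOf col (X ∩ Y) ≡ J → D ⊆ Y
  ⊆-of-pattern {X = X} {Y} t D→J D⊆X refl {v} v∈D with ∈-patternOf⁻ (X ∩ Y) (D→J v∈D)
  ... | w , w∈ , eq with x∈p∩q⁻ X Y w∈
  ... | w∈X , w∈Y = subst (_∈ Y) (unique t w∈X (D⊆X v∈D) eq) w∈Y

-- Stars, coverage and the cleaning procedure.

deg-star : (G : Hypergraph n) (D : Subset n) → deg G D ≡ length (filter (D ⊆?_) G)
deg-star G D = length-map (_─ D) (filter (D ⊆?_) G)

Covered : Hypergraph n → Subset n → Set
Covered G D = Any (λ E → D ⊆ E) G

covered? : (G : Hypergraph n) → Decidable (Covered G)
covered? G D = any? (D ⊆?_) G

covered⇒0<deg : (G : Hypergraph n) (D : Subset n) → Covered G D → 0 < deg G D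
covered⇒0<deg G D c = subst (0 <_) (sym (deg-star G D)) (filter-some (D ⊆?_) c)

_≟ˢ_ : (J J′ : Subset k) → Dec (J ≡ J′)
_≟ˢ_ = ≡-dec _≟ᵇ_

-- `R` lists the patterns whose sets must become strong, `Ds` the sets that may be deleted as light.
-- The threshold for lightness is the fraction `w D / M`, kept as two naturals.
module Cleaning (col : Partition k n) (s M : ℕ) (R : List (Subset k)) (Ds : List (Subset n)) (w : Subset n → ℕ) where

  -- The total weight of the D that can still be deleted as light: a deleted D is no longer covered,
  -- so all light deletions together cost at most the initial Φ.
  Φ : Hypergraph n → ℕ
  Φ G = ∑ (λ D → if does (covered? G D) then w D else 0) Ds

  Φ≤∑w : ∀ G → Φ G ≤ ∑ w Ds
  Φ≤∑w G = ∑-mono Ds (λ {D} _ → pointwise D)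
    where
    pointwise : ∀ D → (if does (covered? G D) then w D else 0) ≤ w D
    pointwise D with does (covered? G D)
    ... | true  = ≤-refl
    ... | false = z≤n

  star rest : Hypergraph n → Subset n → Hypergraph n
  star G D = filter (D ⊆?_) G
  rest G D = filter (¬? ∘ (D ⊆?_)) G

  -- Testing `v ∈ E ─ D` matches the degree of `v` in the link of `D`; the list is empty when `v`
  -- lies in `D`.
  starAt : Hypergraph n → Subset n → Fin n → Hypergraph n
  starAt G D v = filter (λ E → v ∈? E ─ D) (star G D)

  vdeg-link : ∀ G D v → vdeg (link G D) v ≡ length (starAt G D v)
  vdeg-link G D v = length-filter-map (v ∈?_) (_─ D) (star G D)

  covered-rest : ∀ G D {D′} → Covered (rest G D) D′ → Covered G D′
  covered-rest G D c with find c
  ... | E , E∈ , D′⊆E = lose (proj₁ (∈-filter⁻ (¬? ∘ (D ⊆?_)) {xs = G} E∈)) D′⊆E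

  ¬covered-rest : ∀ G D → ¬ Covered (rest G D) D
  ¬covered-rest G D c with find c
  ... | E , E∈ , D⊆E = proj₂ (∈-filter⁻ (¬? ∘ (D ⊆?_)) {xs = G} E∈) D⊆E

  Φ-pointwise : ∀ G D D′ → (if does (covered? (rest G D) D′) then w D′ else 0) ≤ (if does (covered? G D′) then w D′ else 0)
  Φ-pointwise G D D′ with covered? (rest G D) D′ | covered? G D′
  ... | no _  | _      = z≤n
  ... | yes _ | yes _  = ≤-refl
  ... | yes c | no ¬c  = contradiction (covered-rest G D c) ¬c

  Φ-rest : ∀ G D → Φ (rest G D) ≤ Φ G
  Φ-rest G D = ∑-mono Ds (λ {D′} _ → Φ-pointwise G D D′)

  Φ-rest-+ : ∀ G {D} → D ∈ₗ Ds → Covered G D → Φ (rest G D) + w D ≤ Φ G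
  Φ-rest-+ G {D} D∈ c = ∑-mono-+ (Φ-pointwise G D) D∈ at-D
    where
    at-D : (if does (covered? (rest G D) D) then w D else 0) + w D ≤ (if does (covered? G D) then w D else 0)
    at-D with covered? (rest G D) D | covered? G D
    ... | yes c′ | _     = contradiction c′ (¬covered-rest G D)
    ... | no _   | yes _ = ≤-refl
    ... | no _   | no ¬c = contradiction c ¬c

  -- S J collects, from the stars deleted because some E_J is not strong, the edges through the
  -- witnessing vertex v; this retains a 1/s fraction of what was deleted on account of J.
  record Cleaned (G : Hypergraph n) : Set where
    field
      core        : Hypergraph n
      core-unique : Unique core
      core-⊆      : ∀ {E} → E ∈ₗ core → E ∈ₗ G
      core-≤      : length core ≤ length G
      core-strong : ∀ {J} → J ∈ₗ R → ∀ {E} → E ∈ₗ core → Strong s core (restrict col E J)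
      core-heavy  : ∀ {D} → D ∈ₗ Ds → Covered core D → w D ≤ M * deg core D
      S           : Subset k → Hypergraph n
      S-unique    : ∀ J → Unique (S J)
      S-⊆         : ∀ J {E} → E ∈ₗ S J → E ∈ₗ G
      S-avoids    : ∀ J → ¬ InMI col (S J) J
      -- The account of all edges, scaled by `M`: light stars are charged to `Φ`, weak stars to the
      -- sum over `R`, and the rest is the core.
      bound       : M * length G ≤ M * (length core + ∑ (λ J → s * length (S J)) R) + Φ G

  -- Diversity of the link failing at the vertex `v`. For an edge `E` of `G` this is the only
  -- possible failure, since `E` itself makes the link nonempty.
  Weak : Hypergraph n → Subset k → Subset n → Fin n → Set
  Weak G J E v = length (link G (restrict col E J)) ≤ s * vdeg (link G (restrict col E J)) v

  -- Coverage ensures that a deletion removes at least one edge and that `Φ` really drops by `w D`.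
  Light : Hypergraph n → Subset n → Set
  Light G D = Covered G D × M * deg G D < w D

  weak? : ∀ G → Dec (Any (λ J → Any (λ E → ∃ (Weak G J E)) G) R)
  weak? G = any? (λ J → any? (λ E → Fin.any? (λ v → _ ≤? _)) G) R

  light? : ∀ G → Dec (Any (Light G) Ds)
  light? G = any? (λ D → covered? G D ×-dec (_ <? _)) Ds

  finished : ∀ G → Unique G → ¬ Any (λ J → Any (λ E → ∃ (Weak G J E)) G) R → ¬ Any (Light G) Ds → Cleaned G
  finished G u ¬weak ¬light = record
    { core        = G
    ; core-unique = u
    ; core-⊆      = λ E∈ → E∈
    ; core-≤      = ≤-refl
    ; core-strong = λ {J} J∈ {E} E∈ →
        covered⇒0<deg G (restrict col E J) (lose E∈ (restrict-⊆ col E J)) ,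
        λ v → ≰⇒> λ weak → ¬weak (lose J∈ (lose E∈ (v , weak)))
    ; core-heavy  = λ D∈ c → ≮⇒≥ λ light → ¬light (lose D∈ (c , light))
    ; S           = λ _ → []
    ; S-unique    = λ _ → []
    ; S-⊆         = λ _ ()
    ; S-avoids    = λ _ ()
    ; bound       = ≤-trans (*-monoʳ-≤ M (m≤m+n (length G) _)) (m≤m+n _ (Φ G))
    }

  rest-⊆ : ∀ G D {E} → E ∈ₗ rest G D → E ∈ₗ G
  rest-⊆ G D = proj₁ ∘ ∈-filter⁻ (¬? ∘ (D ⊆?_)) {xs = G}

  rest-≤ : ∀ G D → length (rest G D) ≤ length G
  rest-≤ G D = length-filter (¬? ∘ (D ⊆?_)) G

  -- The star costs `M * deg G D`, less than `w D`, and `Φ` pays for it because `D` is no longer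
  -- covered afterwards.
  deleteLight : ∀ G {D} → D ∈ₗ Ds → Light G D → Cleaned (rest G D) → Cleaned G
  deleteLight G {D} D∈ (c , light) C = record
    { core        = core
    ; core-unique = core-unique
    ; core-⊆      = rest-⊆ G D ∘ core-⊆
    ; core-≤      = ≤-trans core-≤ (rest-≤ G D)
    ; core-strong = core-strong
    ; core-heavy  = core-heavy
    ; S           = S
    ; S-unique    = S-unique
    ; S-⊆         = λ J → rest-⊆ G D ∘ S-⊆ J
    ; S-avoids    = S-avoids
    ; bound       = begin
        M * length G
          ≡⟨ cong (M *_) (length-filter-+-¬ (D ⊆?_) G) ⟩
        M * (length (star G D) + length (rest G D))
          ≡⟨ *-distribˡ-+ M (length (star G D)) _ ⟩
        M * length (star G D) + M * length (rest G D)
          ≡⟨ cong (λ d → M * d + M * length (rest G D)) (deg-star G D) ⟨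
        M * deg G D + M * length (rest G D)
          ≤⟨ +-mono-≤ (<⇒≤ light) bound ⟩
        w D + (X + Φ (rest G D))
          ≡⟨ solve 3 (λ a b c → a :+ (b :+ c) := b :+ (c :+ a)) refl (w D) X (Φ (rest G D)) ⟩
        X + (Φ (rest G D) + w D)
          ≤⟨ +-monoʳ-≤ X (Φ-rest-+ G D∈ c) ⟩
        X + Φ G ∎
    }
    where
    open Cleaned C
    open ≤-Reasoning
    X = M * (length core + ∑ (λ J → s * length (S J)) R)

  module _ (G : Hypergraph n) (t : All (IsTransversal col) G) {E : Subset n} (E∈G : E ∈ₗ G) (J : Subset k) (v : Fin n) where

    open IsTransversal

    private
      D = restrict col E J

    starAt⁻ : ∀ {X} → X ∈ₗ starAt G D v → X ∈ₗ G × D ⊆ X × v ∈ X ─ D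
    starAt⁻ X∈ with ∈-filter⁻ (λ X → v ∈? X ─ D) {xs = star G D} X∈
    ... | X∈star , v∈ with ∈-filter⁻ (D ⊆?_) {xs = G} X∈star
    ... | X∈G , D⊆X = X∈G , D⊆X , v∈

    ¬⊆-rest : ∀ {Y} → Y ∈ₗ rest G D → ¬ (D ⊆ Y)
    ¬⊆-rest = proj₂ ∘ ∈-filter⁻ (¬? ∘ (D ⊆?_)) {xs = G}

    -- Since X is transversal and D ⊆ X has pattern within J = π(X ∩ Y), also D ⊆ Y.
    starAt-rest-avoids : ∀ {X Y} → X ∈ₗ starAt G D v → Y ∈ₗ rest G D → patternOf col (X ∩ Y) ≢ J
    starAt-rest-avoids X∈ Y∈ eq with starAt⁻ X∈
    ... | X∈G , D⊆X , _ = ¬⊆-rest Y∈ (λ {x} → ⊆-of-pattern col (All.lookup t X∈G) (proj₂ ∘ ∈-restrict⁻ col E J) D⊆X eq {x})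

    -- Both edges contain v, yet the colour of v is not in J, because D already is the J-part of X.
    starAt-avoids : ∀ {X Y} → X ∈ₗ starAt G D v → Y ∈ₗ starAt G D v → patternOf col (X ∩ Y) ≢ J
    starAt-avoids {X} {Y} X∈ Y∈ refl with starAt⁻ X∈ | starAt⁻ Y∈ | hits (All.lookup t E∈G) (col v)
    ... | X∈G , D⊆X , v∈X─D | _ , _ , v∈Y─D | u , u∈E , eq =
      x∈p─q⇒x∉q X D v∈X─D (subst (_∈ D) (unique (All.lookup t X∈G) (D⊆X u∈D) v∈X eq) u∈D)
      where
      v∈X = p─q⊆p X D v∈X─D
      u∈D : u ∈ D
      u∈D = ∈-restrict⁺ col u∈E (subst (_∈ J) (sym eq) (∈-patternOf⁺ col (x∈p∩q⁺ (v∈X , p─q⊆p Y D v∈Y─D))))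

    -- A mixed pair has one edge containing `D` and one that does not; a pair of new edges shares
    -- `v`, whose colour is then forced outside `J`.
    starAt-++-avoids : ∀ {old} → (∀ {X} → X ∈ₗ old → X ∈ₗ rest G D) → ¬ InMI col old J →
      ¬ InMI col (starAt G D v ++ old) J
    starAt-++-avoids old⊆ ¬old (X , Y , X∈ , Y∈ , X≢Y , eq)
      with ∈-++⁻ (starAt G D v) X∈ | ∈-++⁻ (starAt G D v) Y∈
    ... | inj₂ X∈o | inj₂ Y∈o = ¬old (X , Y , X∈o , Y∈o , X≢Y , eq)
    ... | inj₁ X∈n | inj₂ Y∈o = starAt-rest-avoids X∈n (old⊆ Y∈o) eq
    ... | inj₂ X∈o | inj₁ Y∈n = starAt-rest-avoids Y∈n (old⊆ X∈o) (trans (cong (patternOf col) (∩-comm Y X)) eq)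
    ... | inj₁ X∈n | inj₁ Y∈n = starAt-avoids X∈n Y∈n eq

    -- Weakness at `v` says that the deleted star is at most `s` times its part through `v`. That
    -- part joins `S J`, so the sum over `R` absorbs the loss while `Φ` does not grow.
    deleteWeak : Unique G → J ∈ₗ R → Weak G J E v → Cleaned (rest G D) → Cleaned G
    deleteWeak u J∈ weak C = record
      { core        = core
      ; core-unique = core-unique
      ; core-⊆      = rest-⊆ G D ∘ core-⊆
      ; core-≤      = ≤-trans core-≤ (rest-≤ G D)
      ; core-strong = core-strong
      ; core-heavy  = core-heavy
      ; S           = S′
      ; S-unique    = S′-unique
      ; S-⊆         = S′-⊆
      ; S-avoids    = S′-avoids
      ; bound       = begin
          M * length G
            ≡⟨ cong (M *_) (length-filter-+-¬ (D ⊆?_) G) ⟩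
          M * (length (star G D) + length (rest G D))
            ≡⟨ *-distribˡ-+ M (length (star G D)) _ ⟩
          M * length (star G D) + M * length (rest G D)
            ≤⟨ +-mono-≤ (*-monoʳ-≤ M star≤) bound ⟩
          M * (s * length new) + (M * (length core + ΣS) + Φ (rest G D))
            ≡⟨ solve 5 (λ m a c d e → m :* a :+ (m :* (c :+ d) :+ e) := m :* (c :+ (d :+ a)) :+ e) refl
                 M (s * length new) (length core) ΣS (Φ (rest G D)) ⟩
          M * (length core + (ΣS + s * length new)) + Φ (rest G D)
            ≤⟨ +-mono-≤ (*-monoʳ-≤ M (+-monoʳ-≤ (length core) (∑-mono-+ S≤S′ J∈ S+new≤S′))) (Φ-rest G D) ⟩
          M * (length core + ∑ (λ J′ → s * length (S′ J′)) R) + Φ G ∎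
      }
      where
      open Cleaned C
      open ≤-Reasoning
      new = starAt G D v
      ΣS = ∑ (λ J′ → s * length (S J′)) R
      S′ : Subset k → Hypergraph n
      S′ J′ with J′ ≟ˢ J
      ... | yes _ = new ++ S J′
      ... | no _  = S J′
      S′-unique : ∀ J′ → Unique (S′ J′)
      S′-unique J′ with J′ ≟ˢ J
      -- The two lists are disjoint: new edges contain `D`, older ones come from `rest G D`.
      ... | yes _ = Unique.++⁺ (Unique.filter⁺ _ (Unique.filter⁺ _ u)) (S-unique J′)
        (λ { (X∈n , X∈o) → ¬⊆-rest (S-⊆ J′ X∈o) (λ {x} → proj₁ (proj₂ (starAt⁻ X∈n)) {x}) })
      ... | no _  = S-unique J′
      S′-⊆ : ∀ J′ {X} → X ∈ₗ S′ J′ → X ∈ₗ G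
      S′-⊆ J′ X∈ with J′ ≟ˢ J
      ... | no _  = rest-⊆ G D (S-⊆ J′ X∈)
      ... | yes _ with ∈-++⁻ new X∈
      ...   | inj₁ X∈n = proj₁ (starAt⁻ X∈n)
      ...   | inj₂ X∈o = rest-⊆ G D (S-⊆ J′ X∈o)
      S′-avoids : ∀ J′ → ¬ InMI col (S′ J′) J′
      S′-avoids J′ with J′ ≟ˢ J
      ... | yes refl = starAt-++-avoids (S-⊆ J) (S-avoids J)
      ... | no _     = S-avoids J′
      S≤S′ : ∀ J′ → s * length (S J′) ≤ s * length (S′ J′)
      S≤S′ J′ with J′ ≟ˢ J
      ... | yes _ = *-monoʳ-≤ s (≤-trans (m≤n+m _ (length new)) (≤-reflexive (sym (length-++ new))))
      ... | no _  = ≤-refl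
      S+new≤S′ : s * length (S J) + s * length new ≤ s * length (S′ J)
      S+new≤S′ with J ≟ˢ J
      ... | yes _  = ≤-reflexive (trans (sym (*-distribˡ-+ s (length (S J)) _))
        (cong (s *_) (trans (+-comm (length (S J)) _) (sym (length-++ new)))))
      ... | no J≢J = contradiction refl J≢J
      star≤ : length (star G D) ≤ s * length new
      star≤ = begin
        length (star G D)         ≡⟨ deg-star G D ⟨
        length (link G D)         ≤⟨ weak ⟩
        s * vdeg (link G D) v     ≡⟨ cong (s *_) (vdeg-link G D v) ⟩
        s * length new ∎

  rest-< : ∀ G D → Covered G D → length (rest G D) < length G
  rest-< G D c = filter-notAll (¬? ∘ (D ⊆?_)) G (Any.map (λ D⊆E ¬D⊆E → ¬D⊆E (λ {x} → D⊆E {x})) c)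

  -- Recursion on the number of edges: each deletion removes the star of a covered set, which is
  -- nonempty.
  clean : ∀ G → Unique G → All (IsTransversal col) G → Cleaned G
  clean G u t = go G u t (<-wellFounded (length G))
    where
    go : ∀ G → Unique G → All (IsTransversal col) G → Acc _<_ (length G) → Cleaned G
    go G u t (acc rec) with weak? G | light? G
    ... | no ¬weak | no ¬light = finished G u ¬weak ¬light
    ... | no _ | yes light with find light
    ...   | D , D∈ , l = deleteLight G D∈ l
              (go (rest G D) (Unique.filter⁺ _ u) (All.filter⁺ _ t) (rec (rest-< G D (proj₁ l))))
    go G u t (acc rec) | yes weak | _ with find weak
    ... | J , J∈ , weakJ with find weakJ
    ...   | E , E∈ , v , weakE = deleteWeak G t E∈ J v u J∈ weakE
              (go (rest G D) (Unique.filter⁺ _ u) (All.filter⁺ _ t) (rec (rest-< G D (lose E∈ (restrict-⊆ col E J)))))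
      where D = restrict col E J

-- Enumerating subsets, all of them and by size.

subsets : (n : ℕ) → List (Subset n)
subsets zero    = [] ∷ []
subsets (suc n) = map (false ∷_) (subsets n) ++ map (true ∷_) (subsets n)

∈-subsets : (D : Subset n) → D ∈ₗ subsets n
∈-subsets []          = here refl
∈-subsets (false ∷ D) = ∈-++⁺ˡ (∈-map⁺ (false ∷_) (∈-subsets D))
∈-subsets (true ∷ D)  = ∈-++⁺ʳ _ (∈-map⁺ (true ∷_) (∈-subsets D))

length-subsets : (n : ℕ) → length (subsets n) ≡ 2 ^ n
length-subsets zero    = refl
length-subsets (suc n) = begin
  length (map (false ∷_) (subsets n) ++ map (true ∷_) (subsets n))
    ≡⟨ length-++ (map (false ∷_) (subsets n)) ⟩
  length (map (false ∷_) (subsets n)) + length (map (true ∷_) (subsets n))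
    ≡⟨ cong₂ _+_ (length-map _ (subsets n)) (length-map _ (subsets n)) ⟩
  length (subsets n) + length (subsets n)
    ≡⟨ cong₂ _+_ (length-subsets n) (trans (length-subsets n) (sym (+-identityʳ _))) ⟩
  2 ^ suc n ∎
  where open ≡-Reasoning

subsetsOfSize : (n j : ℕ) → List (Subset n)
subsetsOfSize zero    zero    = [] ∷ []
subsetsOfSize zero    (suc j) = []
subsetsOfSize (suc n) zero    = map (false ∷_) (subsetsOfSize n zero)
subsetsOfSize (suc n) (suc j) = map (true ∷_) (subsetsOfSize n j) ++ map (false ∷_) (subsetsOfSize n (suc j))

∈-subsetsOfSize⁺ : (D : Subset n) (j : ℕ) → ∣ D ∣ ≡ j → D ∈ₗ subsetsOfSize n j
∈-subsetsOfSize⁺ []          zero    _  = here refl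
∈-subsetsOfSize⁺ (false ∷ D) zero    eq = ∈-map⁺ (false ∷_) (∈-subsetsOfSize⁺ D zero eq)
∈-subsetsOfSize⁺ (false ∷ D) (suc j) eq = ∈-++⁺ʳ _ (∈-map⁺ (false ∷_) (∈-subsetsOfSize⁺ D (suc j) eq))
∈-subsetsOfSize⁺ (true ∷ D)  (suc j) eq = ∈-++⁺ˡ (∈-map⁺ (true ∷_) (∈-subsetsOfSize⁺ D j (suc-injective eq)))

∈-subsetsOfSize⁻ : (n j : ℕ) {D : Subset n} → D ∈ₗ subsetsOfSize n j → ∣ D ∣ ≡ j
∈-subsetsOfSize⁻ zero    zero    (here refl) = refl
∈-subsetsOfSize⁻ (suc n) zero    D∈ with ∈-map⁻ (false ∷_) D∈
... | D , D∈′ , refl = ∈-subsetsOfSize⁻ n zero D∈′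
∈-subsetsOfSize⁻ (suc n) (suc j) D∈ with ∈-++⁻ (map (true ∷_) (subsetsOfSize n j)) D∈
... | inj₁ D∈ˡ with ∈-map⁻ (true ∷_) D∈ˡ
...   | D , D∈′ , refl = cong suc (∈-subsetsOfSize⁻ n j D∈′)
∈-subsetsOfSize⁻ (suc n) (suc j) D∈ | inj₂ D∈ʳ with ∈-map⁻ (false ∷_) D∈ʳ
...   | D , D∈′ , refl = ∈-subsetsOfSize⁻ n (suc j) D∈′

-- Pascal's recursion: the two summands are at most `n ^ j` and `n * n ^ j`, which add up to
-- `suc n * n ^ j`.
length-subsetsOfSize : (n j : ℕ) → length (subsetsOfSize n j) ≤ n ^ j
length-subsetsOfSize zero    zero    = ≤-refl
length-subsetsOfSize zero    (suc j) = z≤n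
length-subsetsOfSize (suc n) zero    = ≤-trans (≤-reflexive (length-map _ (subsetsOfSize n zero))) (length-subsetsOfSize n zero)
length-subsetsOfSize (suc n) (suc j) = begin
  length (map (true ∷_) (subsetsOfSize n j) ++ map (false ∷_) (subsetsOfSize n (suc j)))
    ≡⟨ length-++ (map (true ∷_) (subsetsOfSize n j)) ⟩
  length (map (true ∷_) (subsetsOfSize n j)) + length (map (false ∷_) (subsetsOfSize n (suc j)))
    ≡⟨ cong₂ _+_ (length-map _ (subsetsOfSize n j)) (length-map _ (subsetsOfSize n (suc j))) ⟩
  length (subsetsOfSize n j) + length (subsetsOfSize n (suc j))
    ≤⟨ +-mono-≤ (length-subsetsOfSize n j) (length-subsetsOfSize n (suc j)) ⟩
  suc n * n ^ j
    ≤⟨ *-monoʳ-≤ (suc n) (^-monoˡ-≤ j (n≤1+n n)) ⟩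
  suc n * suc n ^ j ∎
  where open ≤-Reasoning

subsetsBelow : (n k : ℕ) → List (Subset n)
subsetsBelow n zero    = []
subsetsBelow n (suc k) = subsetsOfSize n k ++ subsetsBelow n k

∈-subsetsBelow : (k : ℕ) (D : Subset n) → ∣ D ∣ < k → D ∈ₗ subsetsBelow n k
∈-subsetsBelow (suc k) D (s≤s d≤k) with m≤n⇒m<n∨m≡n d≤k
... | inj₁ d<k = ∈-++⁺ʳ _ (∈-subsetsBelow k D d<k)
... | inj₂ d≡k = ∈-++⁺ˡ (∈-subsetsOfSize⁺ D k d≡k)

-- Each size j < k contributes at most (n choose j) · n^(k ∸ j) ≤ n^k.
∑-subsetsBelow : (n k N j : ℕ) → j ≤ k → ∑ (λ D → N * n ^ (k ∸ ∣ D ∣)) (subsetsBelow n j) ≤ j * (N * n ^ k)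
∑-subsetsBelow n k N zero    _   = z≤n
∑-subsetsBelow n k N (suc j) j<k = begin
  ∑ w (subsetsOfSize n j ++ subsetsBelow n j)
    ≡⟨ ∑-++ w (subsetsOfSize n j) (subsetsBelow n j) ⟩
  ∑ w (subsetsOfSize n j) + ∑ w (subsetsBelow n j)
    ≡⟨ cong (_+ ∑ w (subsetsBelow n j)) (∑-cong (subsetsOfSize n j)
         (λ D∈ → cong (λ d → N * n ^ (k ∸ d)) (∈-subsetsOfSize⁻ n j D∈))) ⟩
  ∑ (λ _ → N * n ^ (k ∸ j)) (subsetsOfSize n j) + ∑ w (subsetsBelow n j)
    ≡⟨ cong (_+ ∑ w (subsetsBelow n j)) (∑-const (N * n ^ (k ∸ j)) (subsetsOfSize n j)) ⟩
  length (subsetsOfSize n j) * (N * n ^ (k ∸ j)) + ∑ w (subsetsBelow n j)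
    ≤⟨ +-mono-≤ (*-monoˡ-≤ (N * n ^ (k ∸ j)) (length-subsetsOfSize n j)) (∑-subsetsBelow n k N j (<⇒≤ j<k)) ⟩
  n ^ j * (N * n ^ (k ∸ j)) + j * (N * n ^ k)
    ≡⟨ cong (_+ j * (N * n ^ k)) (solve 3 (λ a b c → a :* (b :* c) := b :* (a :* c)) refl (n ^ j) N (n ^ (k ∸ j))) ⟩
  N * (n ^ j * n ^ (k ∸ j)) + j * (N * n ^ k)
    ≡⟨ cong (λ z → N * z + j * (N * n ^ k)) (trans (sym (^-distribˡ-+-* n j (k ∸ j))) (cong (n ^_) (m+[n∸m]≡n (<⇒≤ j<k)))) ⟩
  N * n ^ k + j * (N * n ^ k) ∎
  where
  open ≤-Reasoning
  w : Subset n → ℕ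
  w D = N * n ^ (k ∸ ∣ D ∣)

-- Regular subgraphs and the iteration over patterns.

InMI-⊆ : {col : Partition k n} {F G : Hypergraph n} {J : Subset k} → (∀ {E} → E ∈ₗ F → E ∈ₗ G) → InMI col F J → InMI col G J
InMI-⊆ F⊆G (X , Y , X∈ , Y∈ , X≢Y , eq) = X , Y , F⊆G X∈ , F⊆G Y∈ , X≢Y , eq

∣J∣<k⇒∃∉ : (J : Subset k) → ∣ J ∣ < k → ∃ (_∉ J)
∣J∣<k⇒∃∉ (false ∷ J) _       = zero , λ ()
∣J∣<k⇒∃∉ (true ∷ J)  (s≤s l) with ∣J∣<k⇒∃∉ J l
... | i , i∉J = suc i , i∉J ∘ drop-there

module Regularity (s : ℕ) .{{_ : NonZero s}} .{{_ : NonZero k}} .{{_ : NonZero n}} (col : Partition k n) where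

  -- Were `J` full, the intersection would meet every colour class, and the transversals `X` and `Y`
  -- would contain each other.
  InMI⇒∣J∣<k : ∀ {F J} → All (IsTransversal col) F → InMI col F J → ∣ J ∣ < k
  InMI⇒∣J∣<k {J = J} t (X , Y , X∈ , Y∈ , X≢Y , refl) = ≤∧≢⇒< (∣p∣≤n J) λ eq →
    let full : ∀ i → i ∈ J
        full = λ i → subst (i ∈_) (sym (∣p∣≡n⇒p≡⊤ eq)) ∈⊤
        fullʳ : ∀ i → i ∈ patternOf col (Y ∩ X)
        fullʳ = λ i → subst (λ Z → i ∈ patternOf col Z) (∩-comm X Y) (full i)
    in X≢Y (⊆-antisym (pattern-full⇒⊆ col (All.lookup t X∈) full) (pattern-full⇒⊆ col (All.lookup t Y∈) fullʳ))

  Regular : Hypergraph n → Set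
  Regular F = (∀ J → InMI col F J → ∀ E → E ∈ₗ F → Strong s F (restrict col E J))
    × (∀ J → InMI col F J → ∀ E → E ∈ₗ F →
         (s ≤ deg F (restrict col E J)) × (length F ≤ 2 * k * n ^ ∣ J ∣ * deg F (restrict col E J)))

  -- `J` misses some colour, and the vertex of `E` of that colour has degree at least 1 in the link;
  -- diversity at this vertex forces more than `s` edges.
  strong⇒s≤deg : ∀ {F J E} → ∣ J ∣ < k → IsTransversal col E → E ∈ₗ F → Strong s F (restrict col E J) →
    s ≤ deg F (restrict col E J)
  strong⇒s≤deg {F} {J} {E} J<k t E∈ (_ , diverse) with ∣J∣<k⇒∃∉ J J<k
  ... | i , i∉J with IsTransversal.hits t i
  ... | v , v∈E , refl = ≤-trans (m≤m*n s (vdeg L v) {{>-nonZero 0<vdeg}}) (<⇒≤ (diverse v))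
    where
    D = restrict col E J
    L = link F D
    0<vdeg : 0 < vdeg L v
    0<vdeg = filter-some (v ∈?_) (lose (∈-map⁺ (_─ D) (∈-filter⁺ (D ⊆?_) E∈ (λ {x} → restrict-⊆ col E J {x})))
      (x∈p∧x∉q⇒x∈p─q v∈E (i∉J ∘ proj₂ ∘ ∈-restrict⁻ col E J)))

  -- The factor lost per round: 2 for the light deletions, `s` for passing from a star to its edges
  -- through one vertex, `1 + 2 ^ k` for choosing among the core and the patterns.
  loss : ℕ
  loss = 2 * s * (1 + 2 ^ k)

  instance
    loss≢0 : NonZero loss
    loss≢0 = m*n≢0 (2 * s) (1 + 2 ^ k) {{m*n≢0 2 s}}

  module Step (R : List (Subset k)) (R≤ : length R ≤ 2 ^ k) (F : Hypergraph n) (u : Unique F)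
    (t : All (IsTransversal col) F) (MI⊆R : ∀ {J} → InMI col F J → J ∈ₗ R) where

    private
      N = length F
      -- With this `M` and the `w` below, lightness reads `deg G D < N / (2 * k * n ^ ∣ D ∣)`,
      -- multiplied through by `2 * k * n ^ k`. `N` stays fixed during the cleaning.
      M = 2 * k * n ^ k
      Ds = subsetsBelow n k
      w : Subset n → ℕ
      w D = N * n ^ (k ∸ ∣ D ∣)

    open Cleaning col s M R Ds w using (Cleaned; clean; Φ; Φ≤∑w)
    open Cleaned (clean F u t) public

    core-transversal : All (IsTransversal col) core
    core-transversal = All.tabulate (All.lookup t ∘ core-⊆)

    core-regular : Regular core
    core-regular = strong , λ J J∈ E E∈ → strong⇒s≤deg {J = J} (InMI⇒∣J∣<k core-transversal J∈) (All.lookup core-transversal E∈) E∈ (strong J J∈ E E∈) , large J J∈ E E∈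
      where
      strong : ∀ J → InMI col core J → ∀ E → E ∈ₗ core → Strong s core (restrict col E J)
      strong J J∈ E E∈ = core-strong (MI⊆R (InMI-⊆ core-⊆ J∈)) E∈
      large : ∀ J → InMI col core J → ∀ E → E ∈ₗ core → length core ≤ 2 * k * n ^ ∣ J ∣ * deg core (restrict col E J)
      -- The threshold was set by `N`, which is at least the size of the core, and `∣ D ∣ ≤ ∣ J ∣`
      -- lets the power of `n` grow.
      large J J∈ E E∈ = ≤-trans core-≤ (≤-trans N≤ (*-monoˡ-≤ (deg core D) (*-monoʳ-≤ (2 * k) (^-monoʳ-≤ n d≤J))))
        where
        open ≤-Reasoning
        D = restrict col E J
        d = ∣ D ∣
        d≤J : d ≤ ∣ J ∣
        d≤J = ∣restrict∣≤∣J∣ col J (All.lookup core-transversal E∈)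
        d<k : d < k
        d<k = ≤-<-trans d≤J (InMI⇒∣J∣<k core-transversal J∈)
        N≤ : N ≤ 2 * k * n ^ d * deg core D
        N≤ = *-cancelʳ-≤ N _ (n ^ (k ∸ d)) {{m^n≢0 n (k ∸ d)}} (begin
          N * n ^ (k ∸ d)
            ≤⟨ core-heavy (∈-subsetsBelow k D d<k) (lose E∈ (restrict-⊆ col E J)) ⟩
          2 * k * n ^ k * deg core D
            ≡⟨ cong (λ z → 2 * k * z * deg core D) (trans (cong (n ^_) (sym (m+[n∸m]≡n (<⇒≤ d<k)))) (^-distribˡ-+-* n d (k ∸ d))) ⟩
          2 * k * (n ^ d * n ^ (k ∸ d)) * deg core D
            ≡⟨ solve 4 (λ a b c e → a :* (b :* c) :* e := a :* b :* e :* c) refl (2 * k) (n ^ d) (n ^ (k ∸ d)) (deg core D) ⟩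
          2 * k * n ^ d * deg core D * n ^ (k ∸ d) ∎)

    size : Maybe (Subset k) → ℕ
    size = maybe (λ J → s * length (S J)) (length core)

    -- `nothing` stands for the core, `just J` for the edges deleted on account of `J`, whose number
    -- `size` bounds by `s * length (S J)`.
    options : List (Maybe (Subset k))
    options = nothing ∷ map just R

    -- The light sets weigh at most `k * (N * n ^ k)` in total, exactly half of `M * N`, so the
    -- other half is left for the options.
    N≤2∑ : N ≤ 2 * ∑ size options
    N≤2∑ = *-cancelˡ-≤ (k * n ^ k) {{m*n≢0 k (n ^ k)}} (+-cancelʳ-≤ (k * (N * n ^ k)) _ _ (begin
      k * n ^ k * N + k * (N * n ^ k)
        ≡⟨ solve 3 (λ a b c → a :* b :* c :+ a :* (c :* b) := con 2 :* a :* b :* c) refl k (n ^ k) N ⟩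
      M * N
        ≤⟨ bound ⟩
      M * (length core + ∑ (λ J → s * length (S J)) R) + Φ F
        ≤⟨ +-monoʳ-≤ (M * (length core + ∑ (λ J → s * length (S J)) R)) (≤-trans (Φ≤∑w F) (∑-subsetsBelow n k N k ≤-refl)) ⟩
      M * (length core + ∑ (λ J → s * length (S J)) R) + k * (N * n ^ k)
        ≡⟨ cong (λ z → M * (length core + sum z) + k * (N * n ^ k)) (map-∘ R) ⟩
      M * ∑ size options + k * (N * n ^ k)
        ≡⟨ cong (_+ k * (N * n ^ k)) (solve 3 (λ a b c → con 2 :* a :* b :* c := a :* b :* (con 2 :* c)) refl k (n ^ k) (∑ size options)) ⟩
      k * n ^ k * (2 * ∑ size options) + k * (N * n ^ k) ∎))
      where
      open ≤-Reasoning
      instance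
        n^k≢0 : NonZero (n ^ k)
        n^k≢0 = m^n≢0 n k

    dichotomy : N ≤ length core * loss ⊎ (∃ λ J → J ∈ₗ R × N ≤ length (S J) * loss)
    dichotomy with ∑≤length*max size options z<s
    ... | y , y∈ , le = choose y y∈ (begin
        N                                  ≤⟨ N≤2∑ ⟩
        2 * ∑ size options                 ≤⟨ *-monoʳ-≤ 2 le ⟩
        2 * (length options * size y)      ≤⟨ *-monoʳ-≤ 2 (*-monoˡ-≤ (size y) (s≤s (≤-trans (≤-reflexive (length-map just R)) R≤))) ⟩
        2 * ((1 + 2 ^ k) * size y) ∎)
      where
      open ≤-Reasoning
      rearrange : ∀ b c → s * (2 * (b * c)) ≡ c * (2 * s * b)
      rearrange = solve 3 (λ a b c → a :* (con 2 :* (b :* c)) := c :* (con 2 :* a :* b)) refl s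
      rearrange′ : ∀ b c → 2 * (b * (s * c)) ≡ c * (2 * s * b)
      rearrange′ = solve 3 (λ a b c → con 2 :* (b :* (a :* c)) := c :* (con 2 :* a :* b)) refl s
      choose : ∀ y → y ∈ₗ options → N ≤ 2 * ((1 + 2 ^ k) * size y) → N ≤ length core * loss ⊎ (∃ λ J → J ∈ₗ R × N ≤ length (S J) * loss)
      choose nothing _ le = inj₁ (begin
        N                                  ≤⟨ le ⟩
        -- The core loses no factor `s`; it is inserted so that both alternatives share the constant
        -- `loss`.
        2 * ((1 + 2 ^ k) * length core)    ≤⟨ m≤n*m _ s ⟩
        s * (2 * ((1 + 2 ^ k) * length core))   ≡⟨ rearrange (1 + 2 ^ k) (length core) ⟩
        length core * loss ∎)
      choose (just J) (there J∈) le with ∈-map⁻ just J∈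
      ... | _ , J∈R , refl = inj₂ (J , J∈R , ≤-trans le (≤-reflexive (rearrange′ (1 + 2 ^ k) (length (S J)))))

  -- Passing to S J removes J from MI for good, so R shrinks and at most 2 ^ k rounds occur.
  regularise : ∀ r → r ≤ 2 ^ k → (R : List (Subset k)) → length R ≤ r → (F : Hypergraph n) → Unique F →
    All (IsTransversal col) F → (∀ {J} → InMI col F J → J ∈ₗ R) →
    ∃ λ F′ → Unique F′ × (∀ {E} → E ∈ₗ F′ → E ∈ₗ F) × length F ≤ length F′ * loss ^ r × Regular F′
  -- With no pattern left `MI` is empty, and regularity holds vacuously.
  regularise zero _ [] _ F u t MI⊆R = F , u , (λ E∈ → E∈) , ≤-reflexive (sym (*-identityʳ _)) ,
    (λ J J∈ → contradiction (MI⊆R J∈) λ ()) , (λ J J∈ → contradiction (MI⊆R J∈) λ ())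
  regularise (suc r) r≤ R R≤ F u t MI⊆R = continue dichotomy
    where
    open Step R (≤-trans R≤ r≤) F u t MI⊆R
    open ≤-Reasoning
    continue : length F ≤ length core * loss ⊎ (∃ λ J → J ∈ₗ R × length F ≤ length (S J) * loss) →
      ∃ λ F′ → Unique F′ × (∀ {E} → E ∈ₗ F′ → E ∈ₗ F) × length F ≤ length F′ * loss ^ suc r × Regular F′
    -- Stopping early is harmless: the remaining rounds would only contribute the factor `loss ^ r`,
    -- which is at least 1.
    continue (inj₁ le) = core , core-unique , core-⊆ ,
      ≤-trans le (*-monoʳ-≤ (length core) (m≤m*n loss (loss ^ r) {{m^n≢0 loss r}})) , core-regular
    continue (inj₂ (J , J∈R , le))
      with regularise r (<⇒≤ r≤) (filter (λ J′ → ¬? (J′ ≟ˢ J)) R)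
             (≤-pred (≤-trans (filter-notAll (λ J′ → ¬? (J′ ≟ˢ J)) R (Any.map (λ J≡ ¬≡ → ¬≡ (sym J≡)) J∈R)) R≤))
             (S J) (S-unique J) (All.tabulate (All.lookup t ∘ S-⊆ J))
             (λ {J′} J′∈ → ∈-filter⁺ (λ J′ → ¬? (J′ ≟ˢ J)) (MI⊆R (InMI-⊆ (S-⊆ J) J′∈)) (λ { refl → S-avoids J J′∈ }))
    ... | F′ , u′ , F′⊆ , le′ , reg = F′ , u′ , S-⊆ J ∘ F′⊆ , (begin
        length F                    ≤⟨ le ⟩
        length (S J) * loss            ≤⟨ *-monoˡ-≤ loss le′ ⟩
        length F′ * loss ^ r * loss       ≡⟨ trans (*-assoc (length F′) (loss ^ r) loss) (cong (length F′ *_) (*-comm (loss ^ r) loss)) ⟩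
        length F′ * loss ^ suc r ∎) , reg

-- Assembling the theorem.

regular-subgraph : (k s n : ℕ) .{{_ : NonZero k}} .{{_ : NonZero s}} .{{_ : NonZero n}} →
  (F : Hypergraph n) → IsKGraph k n F →
  Σ (Hypergraph n) λ F′ → Σ (Partition k n) λ col →
  IsSubgraph F′ F × IsKPartite col F′
  × (k ! * length F ≤ length F′ * (k ^ k * (2 * s * (1 + 2 ^ k)) ^ (2 ^ k)))
  × Regularity.Regular s col F′
regular-subgraph k s n F (u , uni) with ∃-large-rainbowPart k n F uni
-- The iteration starts with all `2 ^ k` patterns; the constant is the colouring factor times
-- `loss ^ (2 ^ k)`.
... | cs , large with Regularity.regularise s (lookup cs) (2 ^ k) ≤-refl (subsets k) (≤-reflexive (length-subsets k))
        (rainbowPart F cs) (Unique.filter⁺ _ u)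
        (All.map (∣E∩part∣≡1⇒transversal (lookup cs)) (rainbowPart-partite F cs uni)) (λ {J} _ → ∈-subsets J)
... | F′ , u′ , F′⊆ , le , reg = F′ , lookup cs ,
    (u′ , All.tabulate (proj₁ ∘ ∈-filter⁻ _ {xs = F} ∘ F′⊆)) ,
    All.tabulate (All.lookup (rainbowPart-partite F cs uni) ∘ F′⊆) ,
    (begin
      k ! * length F                       ≤⟨ large ⟩
      k ^ k * length (rainbowPart F cs)    ≤⟨ *-monoʳ-≤ (k ^ k) le ⟩
      k ^ k * (length F′ * a)              ≡⟨ solve 3 (λ a b c → a :* (b :* c) := b :* (a :* c)) refl (k ^ k) (length F′) a ⟩
      length F′ * (k ^ k * a)              ∎) ,
    reg
  where
  open ≤-Reasoning
  a = (2 * s * (1 + 2 ^ k)) ^ (2 ^ k)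

theorem3p1 : (k s n : ℕ) → 2 ≤ k → 2 ≤ s → 2 * k ≤ s →
  (F : Hypergraph n) → IsKGraph k n F →
  Σ (Hypergraph n) λ F' → Σ (Partition k n) λ col →
    IsSubgraph F' F × IsKPartite col F'
    -- (1) |F'| ≥ c(k,s)|F|, with c(k,s) = k! / (k^k (2s(1+2^k))^(2^k)), cleared of denominators
    × (k ! * length F ≤ length F' * (k ^ k * (2 * s * (1 + 2 ^ k)) ^ (2 ^ k)))
    -- (2) F_J is s-strong in F'
    × ((J : Subset k) → InMI col F' J → (E : Subset n) → E ∈ₗ F' → Strong s F' (restrict col E J))
    -- (3) d(F_J) ≥ s and d(F_J) ≥ |F'| / (2k n^|J|)
    × ((J : Subset k) → InMI col F' J → (E : Subset n) → E ∈ₗ F' →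
         (s ≤ deg F' (restrict col E J))
         × (length F' ≤ 2 * k * n ^ ∣ J ∣ * deg F' (restrict col E J)))
-- Without vertices the powers of `n` may vanish, so this case is separate: the only possible edge
-- is empty and cannot have `k` vertices, which leaves the empty hypergraph.
theorem3p1 k s zero 2≤k _ _ [] _ = [] , (λ ()) , ([] , []) , [] , ≤-reflexive (*-zeroʳ (k !)) , (λ _ ()) , (λ _ ())
theorem3p1 k s zero 2≤k _ _ ([] ∷ F) (_ , refl ∷ _) = contradiction 2≤k λ ()
theorem3p1 k s n@(suc _) 2≤k 2≤s _ F isK =
  regular-subgraph k s n {{>-nonZero (<⇒≤ 2≤k)}} {{>-nonZero (<⇒≤ 2≤s)}} F isK
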